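{- Given two set-strings $\mathcal{S}_1[1..m]$ and $\mathcal{S}_2[1..m]$ over an alphabet $\Sigma$, where $M_{\mathcal{S}_1}=\sum_{i=1}^{m}|\mathcal{S}_1[i]|$ and $M_{\mathcal{S}_2}=\sum_{i=1}^{m}|\mathcal{S}_2[i]|$, one can determine whether they set-parameterized match (i.e. whether $\mathcal{S}_1\approx_p\mathcal{S}_2$) in time $O(M_{\mathcal{S}_1}+M_{\mathcal{S}_2})$ with error probability at most $1/m$.
   Context: $\Sigma=\{1,2,\dots,|\Sigma|\}$ is a finite alphabet. A set-string $\mathcal{S}$ of length $m$ over $\Sigma$ is a sequence $\mathcal{S}[1],\dots,\mathcal{S}[m]$ of subsets $\mathcal{S}[i]\subseteq\Sigma$. Two set-strings $\mathcal{S}_1,\mathcal{S}_2$ of equal length $m$ over $\Sigma$ set-parameterized match, written $\mathcal{S}_1\approx_p\mathcal{S}_2$, if there is a bijection $\pi:\Sigma\to\Sigma$ such that $\pi(\mathcal{S}_1[i])=\mathcal{S}_2[i]$ for all $i\in\{1,\dots,m\}$, where $\pi(A)=\{\pi(a):a\in A\}$. The algorithm is randomized, and the error probability is over its random choices. -}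

module Defs where

open import Data.Bool using (Bool; true; false; not; if_then_else_)
open import Data.Fin using (Fin; toℕ)
open import Data.Fin.Permutation using (Permutation′; _⟨$⟩ʳ_)
open import Data.Fin.Subset using (Subset; _∈_; ∣_∣)
open import Data.Integer using (+_)
open import Data.List as List using (List; []; _∷_; _++_; allFin; concatMap; filterᵇ; cartesianProductWith)
import Data.List.Membership.Propositional as List
open import Data.List.Relation.Unary.Unique.Propositional using (Unique)
open import Data.Nat using (ℕ; zero; suc; _+_; _*_; _∸_; _^_; _/_; _%_; _≡ᵇ_; _<ᵇ_; NonZero)
open import Data.Nat.Properties using (m^n≢0)
open import Data.Product using (∃-syntax; _×_; _,_; proj₁; proj₂)
open import Data.Rational as ℚ using (ℚ)
open import Data.Vec as Vec using (Vec; lookup)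
open import Function using (_∘_)
open import Function.Bundles using (_⇔_)
open import Relation.Binary.PropositionalEquality using (_≡_)
open import Relation.Unary using (Pred; _≐_)

SetString : ℕ → ℕ → Set
SetString σ m = Vec (Subset σ) m

∥_∥ : ∀ {σ m} → SetString σ m → ℕ
∥ S ∥ = Vec.sum (Vec.map ∣_∣ S)

Image : ∀ {σ} → Permutation′ σ → Subset σ → Pred (Fin σ) _
Image π A b = ∃[ a ] (a ∈ A × π ⟨$⟩ʳ a ≡ b)

infix 4 _≈ₚ_
_≈ₚ_ : ∀ {σ m} → SetString σ m → SetString σ m → Set
_≈ₚ_ {σ} {m} S₁ S₂ =
  ∃[ π ] ((i : Fin m) → Image {σ} π (lookup S₁ i) ≐ (_∈ lookup S₂ i))

-- A randomized word RAM with w-bit words.  Programs are written with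
-- structured control flow over finitely many registers and finitely many
-- arrays, each named by a number fixed in the program; array indices are
-- computed words.

data Op : Set where
  add sub mul div mod lt eq : Op

data Exp : Set where
  const : ℕ → Exp
  reg   : ℕ → Exp
  read  : ℕ → Exp → Exp
  op    : Op → Exp → Exp → Exp

data Cmd : Set where
  set        : ℕ → Exp → Cmd
  write      : ℕ → Exp → Exp → Cmd
  random     : ℕ → Cmd
  ifThenElse : Exp → List Cmd → List Cmd → Cmd
  while      : Exp → List Cmd → Cmd

Program : Set
Program = List Cmd

record State : Set where
  constructor state
  field
    regs : ℕ → ℕ
    arrs : ℕ → ℕ → ℕ
    tape : List ℕ    -- the random words not yet drawn

open State public

infixl 9 _[_↦_]
_[_↦_] : ∀ {A : Set} → (ℕ → A) → ℕ → A → ℕ → A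
(f [ x ↦ v ]) y = if x ≡ᵇ y then v else f y

bit : Bool → ℕ
bit b = if b then 1 else 0

module _ (w : ℕ) where

  wrap : ℕ → ℕ
  wrap n = _%_ n (2 ^ w) {{m^n≢0 2 w}}

  -- Arithmetic is modulo 2 ^ w; division and remainder by 0 give 0.
  ⟦_⟧ : Op → ℕ → ℕ → ℕ
  ⟦ add ⟧ a b       = wrap (a + b)
  ⟦ sub ⟧ a b       = wrap (a + (2 ^ w ∸ b))
  ⟦ mul ⟧ a b       = wrap (a * b)
  ⟦ div ⟧ a zero    = 0
  ⟦ div ⟧ a (suc b) = wrap (a / suc b)
  ⟦ mod ⟧ a zero    = 0
  ⟦ mod ⟧ a (suc b) = wrap (a % suc b)
  ⟦ lt ⟧  a b       = wrap (bit (a <ᵇ b))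
  ⟦ eq ⟧  a b       = wrap (bit (a ≡ᵇ b))

  eval : Exp → State → ℕ
  eval (const n)  s = wrap n
  eval (reg x)    s = regs s x
  eval (read a e) s = arrs s a (eval e s)
  eval (op o e f) s = ⟦ o ⟧ (eval e s) (eval f s)

  Config : Set
  Config = List Cmd × State

  draw : ℕ → State → State
  draw x (state r a [])      = state (r [ x ↦ 0 ]) a []
  draw x (state r a (v ∷ t)) = state (r [ x ↦ v ]) a t

  -- One unit of time.  The expressions of a program have bounded size, so
  -- evaluating one takes constant time.
  step : Config → Config
  step ([] , s) = [] , s
  step (set x e ∷ k , s) =
    k , record s { regs = regs s [ x ↦ eval e s ] }
  step (write a e f ∷ k , s) =
    k , record s { arrs = arrs s [ a ↦ arrs s a [ eval e s ↦ eval f s ] ] }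
  step (random x ∷ k , s) = k , draw x s
  step (ifThenElse e p q ∷ k , s) =
    (if eval e s ≡ᵇ 0 then q else p) ++ k , s
  step (while e p ∷ k , s) =
    (if eval e s ≡ᵇ 0 then k else p ++ while e p ∷ k) , s

  steps : ℕ → Config → Config
  steps zero    C = C
  steps (suc t) C = steps t (step C)

  -- T steps draw at most T random words, so a run of T steps never gets past
  -- the end of a tape of length T.
  Tape : ℕ → Set
  Tape T = Vec (Fin (2 ^ w)) T

  allTapes : ∀ T → List (Tape T)
  allTapes zero    = Vec.[] ∷ []
  allTapes (suc T) = cartesianProductWith Vec._∷_ (allFin (2 ^ w)) (allTapes T)

  -- Probability of an event over a uniformly random tape.
  Pr : ∀ T → (Tape T → Bool) → ℚ
  Pr T E = ℚ._/_ (+ List.length (filterᵇ E (allTapes T))) ((2 ^ w) ^ T)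
             {{m^n≢0 (2 ^ w) T {{m^n≢0 2 w}}}}

record Listing {σ m} (S : SetString σ m) : Set where
  field
    elems    : Fin m → List (Fin σ)
    unique   : ∀ i → Unique (elems i)
    complete : ∀ i a → a List.∈ elems i ⇔ a ∈ lookup S i

  -- A set-string is stored as its pairs (position, element) by increasing
  -- position: this takes ∥ S ∥ entries, even if most of the sets are empty.
  entries : List (Fin m × Fin σ)
  entries = concatMap (λ i → List.map (i ,_) (elems i)) (allFin m)

  positions : List ℕ
  positions = List.map (toℕ ∘ proj₁) entries

  characters : List ℕ
  characters = List.map (toℕ ∘ proj₂) entries

-- Registers and array cells that hold no input are initially 0.
at : List ℕ → ℕ → ℕ
at []       _       = 0
at (x ∷ xs) zero    = x
at (x ∷ xs) (suc i) = at xs i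

module _ {σ m} {S₁ S₂ : SetString σ m} (L₁ : Listing S₁) (L₂ : Listing S₂) where
  open Listing

  inputRegs : ℕ → ℕ
  inputRegs = at (m ∷ σ ∷ List.length (entries L₁) ∷ List.length (entries L₂) ∷ [])

  inputArrs : ℕ → ℕ → ℕ
  inputArrs 0 = at (positions L₁)
  inputArrs 1 = at (characters L₁)
  inputArrs 2 = at (positions L₂)
  inputArrs 3 = at (characters L₂)
  inputArrs _ = at []

  run : Program → ∀ w T → Tape w T → Config w
  run P w T r =
    steps w T (P , state inputRegs inputArrs (List.map toℕ (Vec.toList r)))

Halted : ∀ {w} → Config w → Set
Halted (k , _) = k ≡ []

-- The answer is read off register 0.
accepts : ∀ {w} → Config w → Bool
accepts (_ , s) = not (regs s 0 ≡ᵇ 0)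

{-# OPTIONS --safe #-}

-- Let occ s a be the list of positions of the character a in S_s.  Then S₁ ≈ₚ S₂ iff the
-- multisets {occ 1 a : a ∈ Σ} and {occ 2 a : a ∈ Σ} are equal.  Reading the entries of both
-- set-strings merged by position, one inserts all the lists occ s a simultaneously into a trie:
-- each character knows its current node, and since positions only increase, a node has to
-- remember only its latest child.  Counting the characters of S₁ and of S₂ at every node and
-- comparing the counts decides the problem in linear time.  No random word is drawn, so the
-- error probability is 0.

module Submission where

open import Defs
open import Algebra.Properties.CommutativeMonoid.Sum using (sum; sum-cong-≗; sum-remove; sum-permute)
open import Data.Bool as Bool using (Bool; true; false; not; T?; if_then_else_)
open import Data.Bool.Properties using (T-≡; ¬-not)
open import Data.Fin as Fin using (Fin; zero; suc; toℕ; punchIn)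
open import Data.Fin.Permutation as Perm using (Permutation′; _⟨$⟩ʳ_; _⟨$⟩ˡ_; inverseˡ; inverseʳ; insert; insert-punchIn)
open import Data.Fin.Properties using (toℕ-injective; toℕ<n; punchInᵢ≢i)
open import Data.Fin.Subset using (Subset; ∣_∣) renaming (_∈_ to _∈ₛ_)
open import Data.Fin.Subset.Properties using (_∈?_; x∈p⇒∣p-x∣<∣p∣; x∈p∧x≢y⇒x∈p-y)
open import Data.List as List using (List; []; _∷_; _++_; _∷ʳ_; map; filter; filterᵇ; length; concatMap; allFin)
open import Data.List.Membership.Propositional using (_∈_)
open import Data.List.Membership.Propositional.Properties using (∈-filter⁺; ∈-filter⁻; ∈-allFin)
open import Data.List.Properties
  using (filter-++; filter-≐; filter-accept; filter-reject; filter-none; map-++; length-++; length-map;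
         ∷ʳ-injective; ∷ʳ-++; ++-identityʳ)
open import Data.List.Relation.Unary.All as All using (All; []; _∷_)
import Data.List.Relation.Unary.All.Properties as All
open import Data.List.Relation.Unary.AllPairs as AllPairs using (AllPairs; []; _∷_)
import Data.List.Relation.Unary.AllPairs.Properties as AllPairs
open import Data.List.Relation.Unary.Any using (here; there)
open import Data.List.Relation.Unary.Unique.Propositional using (Unique)
open import Data.Nat
open import Data.Nat.DivMod using (m<n⇒m%n≡m; [m+n]%n≡m%n)
open import Data.Nat.Properties
open import Algebra.Properties.CommutativeSemigroup +-commutativeSemigroup using (interchange)
open import Data.Nat.Tactic.RingSolver using (solve-∀)
open import Data.Product using (∃-syntax; Σ-syntax; _×_; _,_; proj₁; proj₂)
import Data.Rational as ℚ
import Data.Rational.Properties as ℚ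
open import Data.Sum using (_⊎_; inj₁; inj₂; [_,_]′)
open import Data.Vec as Vec using (lookup; []; _∷_)
open import Function using (_∘_; _$_; id; case_of_)
open import Function.Bundles using (module Equivalence)
open import Relation.Binary.PropositionalEquality
open import Relation.Nullary using (¬_; yes; no; contradiction)

-- A bijection `π` maps every set of the first string onto the set at the same position of the
-- second exactly when each `a` has the same positions as `π a`. So only the number of characters
-- having each position list matters. The two strings share one trie: a node number then stands for
-- a position list exactly, which makes fingerprints unnecessary and lets the counters of the two
-- strings be compared cell by cell.
--
-- The obstacle is that the time bound involves neither `σ` nor `m`, so no array may be initialised
-- and no loop may run over the alphabet. The encoding therefore relies on memory being zero at the
-- start: every character begins at the root, which is node 0, and stamps hold a position plus one,
-- so that 0 means that there is no child. The only preparation is to write `σ` into the root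
-- counter of each string. Characters that never occur simply stay at the root, and the final
-- comparison runs over nodes, of which there is at most one more than there are entries.

≡⇒≡ᵇ-true : ∀ {x y} → x ≡ y → (x ≡ᵇ y) ≡ true
≡⇒≡ᵇ-true {x} {y} = Equivalence.to T-≡ ∘ ≡⇒≡ᵇ x y

≢⇒≡ᵇ-false : ∀ {x y} → x ≢ y → (x ≡ᵇ y) ≡ false
≢⇒≡ᵇ-false {x} {y} x≢y = ¬-not (x≢y ∘ ≡ᵇ⇒≡ x y ∘ Equivalence.from T-≡)

module _ {A : Set} (f : ℕ → A) {v : A} where

  updated : ∀ {x y} → x ≡ y → (f [ x ↦ v ]) y ≡ v
  updated x≡y rewrite ≡⇒≡ᵇ-true x≡y = refl

  untouched : ∀ {x y} → x ≢ y → (f [ x ↦ v ]) y ≡ f y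
  untouched x≢y rewrite ≢⇒≡ᵇ-false x≢y = refl

-- Fibre sizes of maps on a finite set, and bijections obtained from them.

private
  Σᶠ : ∀ {n} → (Fin n → ℕ) → ℕ
  Σᶠ = sum +-0-commutativeMonoid

count : ∀ {n} → (Fin n → ℕ) → ℕ → ℕ
count f c = Σᶠ (λ a → bit (f a ≡ᵇ c))

count-punchIn : ∀ {n} (f : Fin (suc n) → ℕ) a c →
                count f c ≡ bit (f a ≡ᵇ c) + count (f ∘ punchIn a) c
count-punchIn f a c = sum-remove +-0-commutativeMonoid {i = a} (λ b → bit (f b ≡ᵇ c))

count-cong : ∀ {n} {f g : Fin n → ℕ} → f ≗ g → ∀ c → count f c ≡ count g c
count-cong f≗g c = sum-cong-≗ +-0-commutativeMonoid (λ a → cong (λ x → bit (x ≡ᵇ c)) (f≗g a))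

bit≤1 : ∀ b → bit b ≤ 1
bit≤1 false = z≤n
bit≤1 true  = ≤-refl

count≤ : ∀ {n} (f : Fin n → ℕ) c → count f c ≤ n
count≤ {zero}  f c = z≤n
count≤ {suc n} f c = +-mono-≤ (bit≤1 (f zero ≡ᵇ c)) (count≤ (f ∘ suc) c)

count-const : ∀ n {c d} → c ≡ d → count {n} (λ _ → c) d ≡ n
count-const zero    c≡d = refl
count-const (suc n) c≡d rewrite count-const n c≡d | ≡⇒≡ᵇ-true c≡d = refl

count-absent : ∀ {n} (f : Fin n → ℕ) c → (∀ a → f a ≢ c) → count f c ≡ 0
count-absent {zero}  f c f≢c = refl
count-absent {suc n} f c f≢c
  rewrite ≢⇒≡ᵇ-false (f≢c zero) = count-absent (f ∘ suc) c (f≢c ∘ suc)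

count-witness : ∀ {n} (f : Fin n → ℕ) c → count f c ≢ 0 → ∃[ a ] f a ≡ c
count-witness {zero}  f c pos = contradiction refl pos
count-witness {suc n} f c pos with f zero ≟ c
... | yes e≡ = zero , e≡
... | no  ne = let a , e≡ = count-witness (f ∘ suc) c
                     (pos ∘ trans (cong (λ b → bit b + count (f ∘ suc) c) (≢⇒≡ᵇ-false ne)))
               in suc a , e≡

-- `r` counts the indices other than `a`, the part common to both counts. The strict bound `r c < n`
-- later keeps a counter from overflowing when a character is put back.
count-replace : ∀ {n} (f g : Fin n → ℕ) a → (∀ b → b ≢ a → g b ≡ f b) →
  Σ[ r ∈ (ℕ → ℕ) ] (∀ c → count f c ≡ bit (f a ≡ᵇ c) + r c)
       × (∀ c → count g c ≡ bit (g a ≡ᵇ c) + r c)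
       × (∀ c → r c < n)
count-replace {suc n} f g a same =
  count (f ∘ punchIn a) , count-punchIn f a
  , (λ c → trans (count-punchIn g a c)
      (cong (bit (g a ≡ᵇ c) +_) (count-cong (λ b → same (punchIn a b) (punchInᵢ≢i a b)) c)))
  , s≤s ∘ count≤ (f ∘ punchIn a)

permutation⇒counts : ∀ {n} (f g : Fin n → ℕ) (π : Permutation′ n) →
                     (∀ a → f a ≡ g (π ⟨$⟩ʳ a)) → ∀ c → count f c ≡ count g c
permutation⇒counts f g π f≗gπ c = trans (count-cong f≗gπ c)
  (sym (sum-permute +-0-commutativeMonoid (λ a → bit (g a ≡ᵇ c)) π))

-- Induction on `n`: some `j` has `g j ≡ f zero`; match `zero` with `j`, remove both, and their
-- equal contributions cancel from the remaining counts. Since both domains have `n` elements,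
-- agreement at the values of `f` suffices, so it is enough to inspect nodes that hold characters of
-- the first string.
counts⇒permutation : ∀ {n} (f g : Fin n → ℕ) → (∀ a → count f (f a) ≡ count g (f a)) →
                     ∃[ π ] (∀ a → f a ≡ g (_⟨$⟩ʳ_ {n} {n} π a))
counts⇒permutation {zero}  f g e≡ = Perm.id , λ ()
counts⇒permutation {suc n} f g e≡ = insert zero j π , λ where
    zero    → sym gj≡f0
    (suc a) → trans (f≗ a) (cong g (sym (insert-punchIn zero j π a)))
  where
  occurs : count g (f zero) ≢ 0
  occurs none with () ← trans (sym (trans (e≡ zero) none))
    (cong (λ b → bit b + count (f ∘ suc) (f zero)) (≡⇒≡ᵇ-true {f zero} refl))
  j = proj₁ (count-witness g (f zero) occurs)
  gj≡f0 = proj₂ (count-witness g (f zero) occurs)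
  rest : ∃[ π ] (∀ a → f (suc a) ≡ g (punchIn j (_⟨$⟩ʳ_ {n} {n} π a)))
  rest = counts⇒permutation (f ∘ suc) (g ∘ punchIn j) λ a →
    +-cancelˡ-≡ (bit (f zero ≡ᵇ f (suc a))) _ _
      (trans (e≡ (suc a)) (trans (count-punchIn g j (f (suc a)))
        (cong (λ x → bit (x ≡ᵇ f (suc a)) + count (g ∘ punchIn j) (f (suc a))) gj≡f0)))
  π = proj₁ rest
  f≗ = proj₂ rest

-- Occurrence lists of characters, and matching expressed through them.

module _ {σ m : ℕ} where

  occ : Fin σ → List (Fin m × Fin σ) → List (Fin m)
  occ a = map proj₁ ∘ filter (λ e → proj₂ e Fin.≟ a)

  occ-++ : ∀ a D E → occ a (D ++ E) ≡ occ a D ++ occ a E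
  occ-++ a D E = trans (cong (map proj₁) (filter-++ _ D E)) (map-++ proj₁ (filter _ D) _)

  occ-∷-≡ : ∀ {a b i D} → b ≡ a → occ a ((i , b) ∷ D) ≡ i ∷ occ a D
  occ-∷-≡ = cong (map proj₁) ∘ filter-accept (λ e → proj₂ e Fin.≟ _)

  occ-∷-≢ : ∀ {a b i D} → b ≢ a → occ a ((i , b) ∷ D) ≡ occ a D
  occ-∷-≢ = cong (map proj₁) ∘ filter-reject (λ e → proj₂ e Fin.≟ _)

  occ-absent : ∀ a i xs → ¬ a ∈ xs → occ a (map (i ,_) xs) ≡ []
  occ-absent a i []       a∉ = refl
  occ-absent a i (x ∷ xs) a∉ =
    trans (occ-∷-≢ (a∉ ∘ here ∘ sym)) (occ-absent a i xs (a∉ ∘ there))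

  occ-present : ∀ a i {xs} → Unique xs → a ∈ xs → occ a (map (i ,_) xs) ≡ i ∷ []
  occ-present a i {x ∷ xs} (x∉ ∷ _) (here a≡x) = trans (occ-∷-≡ (sym a≡x))
    (cong (i ∷_) (occ-absent a i xs (λ a∈ → All.lookup x∉ a∈ (sym a≡x))))
  occ-present a i (x∉ ∷ u) (there a∈) =
    trans (occ-∷-≢ (All.lookup x∉ a∈)) (occ-present a i u a∈)

  support : SetString σ m → Fin σ → List (Fin m)
  support S a = filter (λ i → a ∈? lookup S i) (allFin m)

  -- The block of position `i` contributes `i` once if `a` lies in the set, by `unique`, and nothing
  -- otherwise. The order in which a listing enumerates each set thus disappears, and only `S`
  -- remains.
  occ-entries : ∀ {S : SetString σ m} (L : Listing S) a → occ a (Listing.entries L) ≡ support S a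
  occ-entries {S} L a = go (allFin m)
    where
    open Listing L
    open Equivalence
    go : ∀ is → occ a (concatMap (λ i → map (i ,_) (elems i)) is) ≡ filter (λ i → a ∈? lookup S i) is
    go []       = refl
    go (i ∷ is) = trans (occ-++ a (map (i ,_) (elems i)) _) (trans (cong (_ ++_) (go is)) here-i)
      where
      here-i : occ a (map (i ,_) (elems i)) ++ filter (λ i → a ∈? lookup S i) is
               ≡ filter (λ i → a ∈? lookup S i) (i ∷ is)
      here-i with a ∈? lookup S i
      ... | yes a∈ rewrite occ-present a i (unique i) (from (complete i a) a∈) = refl
      ... | no  a∉ rewrite occ-absent a i (elems i) (a∉ ∘ to (complete i a)) = refl

  support-≡⇒∈ : ∀ {S S′ : SetString σ m} {a b} → support S a ≡ support S′ b →
                ∀ i → a ∈ₛ lookup S i → b ∈ₛ lookup S′ i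
  support-≡⇒∈ {S} {S′} {a} {b} e≡ i a∈ =
    proj₂ (∈-filter⁻ (λ i → b ∈? lookup S′ i) {xs = allFin m}
      (subst (i ∈_) e≡ (∈-filter⁺ (λ i → a ∈? lookup S i) (∈-allFin i) a∈)))

  supports⇒≈ₚ : ∀ {S₁ S₂ : SetString σ m} (π : Permutation′ σ) →
                (∀ a → support S₁ a ≡ support S₂ (π ⟨$⟩ʳ a)) → S₁ ≈ₚ S₂
  supports⇒≈ₚ {S₁} {S₂} π e≡ = π , λ i →
      (λ { (a , a∈ , refl) → support-≡⇒∈ {S₁} {S₂} (e≡ a) i a∈ })
    , (λ {b} b∈ → π ⟨$⟩ˡ b
        , support-≡⇒∈ {S₂} {S₁} (sym (e≡ _)) i (subst (_∈ₛ lookup S₂ i) (sym (inverseʳ π)) b∈)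
        , inverseʳ π)

  ≈ₚ⇒supports : ∀ {S₁ S₂ : SetString σ m} ((π , _) : S₁ ≈ₚ S₂) →
                ∀ a → support S₁ a ≡ support S₂ (π ⟨$⟩ʳ a)
  ≈ₚ⇒supports {S₁} {S₂} (π , image) a = filter-≐ (λ i → a ∈? lookup S₁ i) (λ i → π ⟨$⟩ʳ a ∈? lookup S₂ i)
    ( (λ {i} a∈ → proj₁ (image i) (a , a∈ , refl))
    , (λ {i} πa∈ → let a′ , a′∈ , e≡ = proj₂ (image i) πa∈
                   in subst (_∈ₛ lookup S₁ i)
                        (trans (sym (inverseˡ π)) (trans (cong (π ⟨$⟩ˡ_) e≡) (inverseˡ π))) a′∈))
    (allFin m)

  -- Deleting the head from `p` lowers its cardinality and keeps the tail inside, because the tail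
  -- avoids the head.
  unique⇒length≤ : ∀ {p : Subset σ} {xs} → Unique xs → All (_∈ₛ p) xs → length xs ≤ ∣ p ∣
  unique⇒length≤ []       []        = z≤n
  unique⇒length≤ {p} (x∉ ∷ u) (x∈ ∷ xs∈) = ≤-<-trans
    (unique⇒length≤ u (All.zipWith (λ (x≢y , y∈) → x∈p∧x≢y⇒x∈p-y y∈ (x≢y ∘ sym)) (x∉ , xs∈)))
    (x∈p⇒∣p-x∣<∣p∣ x∈)

  length-entries : ∀ {S : SetString σ m} (L : Listing S) → length (Listing.entries L) ≤ ∥ S ∥
  length-entries {S} L = go id S λ i →
      unique⇒length≤ (unique i) (All.tabulate (λ {a} → Equivalence.to (complete i a)))
    where
    open Listing L
    -- Positions enter through a reindexing `h`, so that the induction can follow the vector while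
    -- `elems` stays fixed.
    go : ∀ {k} (h : Fin k → Fin m) (V : SetString σ k) →
         (∀ i → length (elems (h i)) ≤ ∣ lookup V i ∣) →
         length (concatMap (λ i → map (i ,_) (elems i)) (List.tabulate h)) ≤ ∥ V ∥
    go h []      le = z≤n
    go h (p ∷ V) le = ≤-trans
      (≤-reflexive (trans (length-++ (map (h zero ,_) (elems (h zero))))
                          (cong (_+ length (concatMap (λ i → map (i ,_) (elems i)) (List.tabulate (h ∘ suc))))
                                (length-map (h zero ,_) (elems (h zero))))))
      (+-mono-≤ (le zero) (go (h ∘ suc) V (le ∘ suc)))

  _⊑_ : Fin m × Fin σ → Fin m × Fin σ → Set
  e ⊑ e′ = proj₁ e Fin.≤ proj₁ e′

  entries-sorted : ∀ {S : SetString σ m} (L : Listing S) → AllPairs _⊑_ (Listing.entries L)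
  entries-sorted L = AllPairs.concat⁺
    (All.map⁺ (All.universal (λ i → AllPairs.map⁺ (same i (elems i))) (allFin m)))
    (AllPairs.map⁺ (AllPairs.tabulate⁺-< λ {i} {j} i<j →
      All.map⁺ (All.universal (λ _ → All.map⁺ (All.universal (λ _ → <⇒≤ i<j) (elems j))) (elems i))))
    where
    open Listing L
    same : ∀ i xs → AllPairs (λ x y → (i , x) ⊑ (i , y)) xs
    same i []       = []
    same i (x ∷ xs) = All.universal (λ _ → ≤-refl) xs ∷ same i xs

-- Tries whose nodes remember only their latest child.

∷ʳ≢[] : ∀ {A : Set} (xs : List A) {x} → xs ∷ʳ x ≢ []
∷ʳ≢[] []      ()
∷ʳ≢[] (_ ∷ _) ()

-- `path c` is ghost data, the positions from the root to node `c`; the program never stores it.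
-- Nodes are the numbers below `next`, and `unstamped` ensures that a newly allocated node starts
-- without children.
record Trie {m} (path : ℕ → List (Fin m)) (stamp child : ℕ → ℕ) (next : ℕ) : Set where
  field
    path-injective : ∀ {c d} → c < next → d < next → path c ≡ path d → c ≡ d
    -- The latest edge leaving a node is the only one whose target is remembered.
    parent : ∀ {d p i} → d < next → path d ≡ p ∷ʳ i →
             ∃[ c ] c < next × path c ≡ p ×
               (suc (toℕ i) < stamp c ⊎ stamp c ≡ suc (toℕ i) × child c ≡ d)
    latest : ∀ {c i} → c < next → stamp c ≡ suc (toℕ i) →
             child c < next × path (child c) ≡ path c ∷ʳ i
    unstamped : ∀ {c} → next ≤ c → stamp c ≡ 0

open Trie

singleton : ∀ {m} → Trie {m} (λ _ → []) (λ _ → 0) (λ _ → 0) 1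
singleton = record
  { path-injective = λ { (s≤s z≤n) (s≤s z≤n) _ → refl }
  ; parent         = λ {_} {p} _ e → contradiction (sym e) (∷ʳ≢[] p)
  ; latest         = λ _ ()
  ; unstamped      = λ _ → refl
  }

-- Following an existing edge overwrites two cells with the values they already hold, which gives
-- functions that are equal only pointwise.
trie-cong : ∀ {m} {path : ℕ → List (Fin m)} {stamp stamp′ child child′ next} →
            stamp′ ≗ stamp → child′ ≗ child →
            Trie path stamp child next → Trie path stamp′ child′ next
trie-cong {path = path} {next = next} s≗ c≗ t = record
  { path-injective = path-injective t
  ; parent         = λ d< e → case parent t d< e of λ where
      (c , c< , pc , inj₁ j<)       → c , c< , pc , inj₁ (subst (_ <_) (sym (s≗ c)) j<)
      (c , c< , pc , inj₂ (st , ch)) → c , c< , pc , inj₂ (trans (s≗ c) st , trans (c≗ c) ch)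
  ; latest         = λ {c} {i} c< st → subst (λ d → d < next × path d ≡ path c ∷ʳ i) (sym (c≗ c))
                       (latest t c< (trans (sym (s≗ c)) st))
  ; unstamped      = λ {c} n≤c → trans (s≗ c) (unstamped t n≤c)
  }

-- d is the i-child of c, which is the node next when c has no i-child yet.
Descent : (c v : ℕ) (stamp child : ℕ → ℕ) (next d next′ : ℕ) → Set
Descent c v stamp child next d next′ =
  stamp c ≡ v × d ≡ child c × next′ ≡ next ⊎ stamp c ≢ v × d ≡ next × next′ ≡ suc next

-- If the stamp is that of `i`, `latest` supplies the child. Otherwise the stamp is smaller, and no
-- `i`-child can exist: its parent would be `c` by `path-injective`, and `parent` would force a
-- stamp of at least `suc (toℕ i)`. A fresh node therefore keeps paths distinct.
descend : ∀ {m} {path : ℕ → List (Fin m)} {stamp child next} {c i d next′} →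
  Trie path stamp child next → c < next → stamp c ≤ suc (toℕ i) →
  Descent c (suc (toℕ i)) stamp child next d next′ →
  ∃[ path′ ] (∀ {e} → e < next → path′ e ≡ path e) × next ≤ next′
           × d < next′ × path′ d ≡ path c ∷ʳ i
           × Trie path′ (stamp [ c ↦ suc (toℕ i) ]) (child [ c ↦ d ]) next′
descend {path = path} {stamp} {child} {c = c} {i} t c< _ (inj₁ (old , refl , refl)) =
  path , (λ _ → refl) , ≤-refl , proj₁ (latest t c< old) , proj₂ (latest t c< old)
  , trie-cong (same stamp (sym old)) (same child refl) t
  where
  same : ∀ (f : ℕ → ℕ) {v} → v ≡ f c → (f [ c ↦ v ]) ≗ f
  same f v≡ e with c ≟ e
  ... | yes refl = trans (updated f {x = c} refl) v≡
  ... | no  c≢e  = untouched f c≢e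
descend {path = path} {stamp} {child} {next} {c} {i} t c< st≤ (inj₂ (new , refl , refl)) =
  path′ , old , n≤1+n next , ≤-refl , newest , record
    { path-injective = inj
    ; parent         = par
    ; latest         = lat
    ; unstamped      = λ n≤e → trans (stamp-other (<⇒≢ (<-≤-trans c< (≤-trans (n≤1+n next) n≤e))))
                                     (unstamped t (≤-trans (n≤1+n next) n≤e))
    }
  where
  path′  = path [ next ↦ path c ∷ʳ i ]
  stamp′ = stamp [ c ↦ suc (toℕ i) ]
  child′ = child [ c ↦ next ]

  old : ∀ {e} → e < next → path′ e ≡ path e
  old e< = untouched path (>⇒≢ e<)
  newest : path′ next ≡ path c ∷ʳ i
  newest = updated path {x = next} refl
  stamp-same : stamp′ c ≡ suc (toℕ i)
  stamp-same = updated stamp {x = c} refl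
  child-same : child′ c ≡ next
  child-same = updated child {x = c} refl
  stamp-other : ∀ {e} → c ≢ e → stamp′ e ≡ stamp e
  stamp-other = untouched stamp

  split : ∀ {e} → e < suc next → e < next ⊎ e ≡ next
  split e< = m<1+n⇒m<n∨m≡n e<

  absent : ∀ {e} → e < next → path e ≢ path c ∷ʳ i
  absent e< pe with parent t e< pe
  ... | b , b< , pb , s with path-injective t b< c< pb
  ...   | refl = [ (λ j< → <⇒≱ j< st≤) , (λ (e , _) → new e) ]′ s

  inj : ∀ {e f} → e < suc next → f < suc next → path′ e ≡ path′ f → e ≡ f
  inj e< f< pe with split e< | split f<
  ... | inj₁ e<n  | inj₁ f<n  = path-injective t e<n f<n (trans (sym (old e<n)) (trans pe (old f<n)))
  ... | inj₁ e<n  | inj₂ refl = contradiction (trans (sym (old e<n)) (trans pe newest)) (absent e<n)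
  ... | inj₂ refl | inj₁ f<n  = contradiction (trans (sym (old f<n)) (trans (sym pe) newest)) (absent f<n)
  ... | inj₂ refl | inj₂ refl = refl

  par : ∀ {d p j} → d < suc next → path′ d ≡ p ∷ʳ j →
        ∃[ b ] b < suc next × path′ b ≡ p ×
          (suc (toℕ j) < stamp′ b ⊎ stamp′ b ≡ suc (toℕ j) × child′ b ≡ d)
  par {p = p} d< pd with split d<
  ... | inj₂ refl with ∷ʳ-injective (path c) p (trans (sym newest) pd)
  ...   | refl , refl = c , m≤n⇒m≤1+n c< , old c< , inj₂ (stamp-same , child-same)
  par {d} {p} {j} d< pd | inj₁ d<n with parent t d<n (trans (sym (old d<n)) pd)
  ... | b , b< , pb , s with c ≟ b
  ...   | no c≢b = b , m≤n⇒m≤1+n b< , trans (old b<) pb ,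
          subst₂ (λ x y → suc (toℕ j) < x ⊎ x ≡ suc (toℕ j) × y ≡ d)
            (sym (stamp-other c≢b)) (sym (untouched child c≢b)) s
  -- The new edge displaces the remembered child of `c`. Whether `d` was that child or an earlier
  -- one, its stamp is strictly below the new one, so it falls under the first alternative.
  ...   | yes refl = c , m≤n⇒m≤1+n c< , trans (old c<) pb , inj₁ (subst (suc (toℕ j) <_) (sym stamp-same)
          ([ (λ j< → <-≤-trans j< st≤) , (λ (e , _) → subst (_< suc (toℕ i)) e (≤∧≢⇒< st≤ new)) ]′ s))

  lat : ∀ {b j} → b < suc next → stamp′ b ≡ suc (toℕ j) →
        child′ b < suc next × path′ (child′ b) ≡ path′ b ∷ʳ j
  lat {b} {j} b< st with c ≟ b
  ... | yes refl = subst (λ x → x < suc next × path′ x ≡ path′ c ∷ʳ j) (sym child-same)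
          (≤-refl , trans newest (cong₂ _∷ʳ_ (sym (old c<))
                      (toℕ-injective (suc-injective (trans (sym stamp-same) st)))))
  ... | no c≢b with split b<
  -- The fresh node differs from `c` and still has stamp 0, which encodes no position.
  ...   | inj₂ refl = contradiction (trans (sym (trans (stamp-other c≢b) (unstamped t ≤-refl))) st) λ ()
  ...   | inj₁ b<n =
          let ch< , pch = latest t b<n (trans (sym (stamp-other c≢b)) st)
          in subst (λ x → x < suc next × path′ x ≡ path′ b ∷ʳ j) (sym (untouched child c≢b))
               (m≤n⇒m≤1+n ch< , trans (old ch<) (trans pch (cong (_∷ʳ j) (sym (old b<n)))))

-- Proof rules for the word RAM, counting steps.

module _ (w : ℕ) where

  -- A halted configuration steps to itself, so B is an upper bound on the running time.
  record Halts (B : ℕ) (C : Config w) (Q : State → Set) : Set where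
    constructor halts
    field
      final : State
      runs  : steps w B C ≡ ([] , final)
      post  : Q final

  -- A wrapper from which unification recovers e and s.
  record Evaluates (e : Exp) (s : State) (v : ℕ) : Set where
    constructor evaluates
    field
      value : eval w e s ≡ v

  steps-+ : ∀ B B′ C → steps w (B + B′) C ≡ steps w B′ (steps w B C)
  steps-+ zero    B′ C = refl
  steps-+ (suc B) B′ C = steps-+ B B′ (step w C)

  steps-halted : ∀ B s → steps w B ([] , s) ≡ ([] , s)
  steps-halted zero    s = refl
  steps-halted (suc B) s = steps-halted B s

  halts-map : ∀ {B C} {Q Q′ : State → Set} → (∀ {s} → Q s → Q′ s) → Halts B C Q → Halts B C Q′
  halts-map f (halts s h q) = halts s h (f q)

  module _ {Q : State → Set} where

    halts-≤ : ∀ {B B′ C} → B ≤ B′ → Halts B C Q → Halts B′ C Q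
    halts-≤ {B} {C = C} B≤B′ (halts s h q) with m≤n⇒∃[o]m+o≡n B≤B′
    ... | k , refl = halts s (trans (steps-+ B k C) (trans (cong (steps w k) h) (steps-halted k s))) q

    module _ {B : ℕ} {k : List Cmd} {s : State} where

      set-rule : ∀ {x e v} → Evaluates e s v →
        Halts B (k , record s { regs = regs s [ x ↦ v ] }) Q → Halts (suc B) (set x e ∷ k , s) Q
      set-rule (evaluates refl) (halts s h q) = halts s h q

      write-rule : ∀ {a e f u v} → Evaluates e s u → Evaluates f s v →
        Halts B (k , record s { arrs = arrs s [ a ↦ arrs s a [ u ↦ v ] ] }) Q →
        Halts (suc B) (write a e f ∷ k , s) Q
      write-rule (evaluates refl) (evaluates refl) (halts s h q) = halts s h q

      then-rule : ∀ {e p q v} → Evaluates e s (suc v) →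
        Halts B (p ++ k , s) Q → Halts (suc B) (ifThenElse e p q ∷ k , s) Q
      then-rule {p = p} {q} (evaluates e≡) (halts f h post) =
        halts f (trans (cong (λ v → steps w B ((if v ≡ᵇ 0 then q else p) ++ k , s)) e≡) h) post

      else-rule : ∀ {e p q} → Evaluates e s 0 →
        Halts B (q ++ k , s) Q → Halts (suc B) (ifThenElse e p q ∷ k , s) Q
      else-rule {p = p} {q} (evaluates e≡) (halts f h post) =
        halts f (trans (cong (λ v → steps w B ((if v ≡ᵇ 0 then q else p) ++ k , s)) e≡) h) post

      enter-rule : ∀ {e p v} → Evaluates e s (suc v) →
        Halts B (p ++ while e p ∷ k , s) Q → Halts (suc B) (while e p ∷ k , s) Q
      enter-rule {e} {p} (evaluates e≡) (halts f h post) =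
        halts f (trans (cong (λ v → steps w B ((if v ≡ᵇ 0 then k else p ++ while e p ∷ k) , s)) e≡) h) post

      exit-rule : ∀ {e p} → Evaluates e s 0 →
        Halts B (k , s) Q → Halts (suc B) (while e p ∷ k , s) Q
      exit-rule {e} {p} (evaluates e≡) (halts f h post) =
        halts f (trans (cong (λ v → steps w B ((if v ≡ᵇ 0 then k else p ++ while e p ∷ k) , s)) e≡) h) post

  wrap-small : ∀ {x} → x < 2 ^ w → wrap w x ≡ x
  wrap-small = m<n⇒m%n≡m {{m^n≢0 2 w}}

  module _ (1< : 1 < 2 ^ w) {s : State} where

    eval-add : ∀ {e f x y} → eval w e s ≡ x → eval w f s ≡ y → x + y < 2 ^ w →
               Evaluates (op add e f) s (x + y)
    eval-add refl refl x+y< = evaluates (wrap-small x+y<)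

    eval-inc : ∀ {e x} → eval w e s ≡ x → suc x < 2 ^ w → Evaluates (op add e (const 1)) s (suc x)
    eval-inc {x = x} refl x< = evaluates $
      trans (cong (wrap w) (trans (cong (x +_) (wrap-small 1<)) (+-comm x 1))) (wrap-small x<)

    -- Subtraction adds the complement of 1, which yields `x + 2 ^ w`; the wrap removes the extra
    -- `2 ^ w`.
    eval-dec : ∀ {e x} → eval w e s ≡ suc x → suc x < 2 ^ w → Evaluates (op sub e (const 1)) s x
    eval-dec {e} {x} e≡ x< = evaluates $ begin
      wrap w (eval w e s + (2 ^ w ∸ wrap w 1)) ≡⟨ cong₂ (λ u v → wrap w (u + (2 ^ w ∸ v))) e≡ (wrap-small 1<) ⟩
      wrap w (suc x + (2 ^ w ∸ 1))             ≡⟨ cong (wrap w) (+-suc x (2 ^ w ∸ 1)) ⟨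
      wrap w (x + (1 + (2 ^ w ∸ 1)))           ≡⟨ cong (λ u → wrap w (x + u)) (m+[n∸m]≡n (<⇒≤ 1<)) ⟩
      wrap w (x + 2 ^ w)                       ≡⟨ [m+n]%n≡m%n x (2 ^ w) {{m^n≢0 2 w}} ⟩
      wrap w x                                 ≡⟨ wrap-small (<-trans ≤-refl x<) ⟩
      x                                        ∎
      where open ≡-Reasoning

    wrap-true : ∀ {b} → b ≡ true → wrap w (bit b) ≡ 1
    wrap-true refl = wrap-small 1<

    wrap-false : ∀ {b} → b ≡ false → wrap w (bit b) ≡ 0
    wrap-false refl = wrap-small (<-trans z<s 1<)

    eval-lt : ∀ {e f x y} → eval w e s ≡ x → eval w f s ≡ y → x < y → Evaluates (op lt e f) s 1
    eval-lt refl refl x<y = evaluates $ wrap-true (Equivalence.to T-≡ (<⇒<ᵇ x<y))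

    eval-≮ : ∀ {e f x y} → eval w e s ≡ x → eval w f s ≡ y → ¬ x < y → Evaluates (op lt e f) s 0
    eval-≮ {x = x} {y} refl refl x≮y = evaluates $
      wrap-false (¬-not (x≮y ∘ <ᵇ⇒< x y ∘ Equivalence.from T-≡))

    eval-eq : ∀ {e f x y} → eval w e s ≡ x → eval w f s ≡ y → x ≡ y → Evaluates (op eq e f) s 1
    eval-eq refl refl x≡y = evaluates $ wrap-true (≡⇒≡ᵇ-true x≡y)

    eval-≢ : ∀ {e f x y} → eval w e s ≡ x → eval w f s ≡ y → x ≢ y → Evaluates (op eq e f) s 0
    eval-≢ refl refl x≢y = evaluates $ wrap-false (≢⇒≡ᵇ-false x≢y)

-- Registers: 0 answer (initially m ≠ 0), 1 the alphabet size, 2/3 the numbers of entries,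
-- 4/5 the next entry, 6 its position + 1, 7 its character, 8 the node of that character,
-- 9 the number of nodes, 10 the node the character moves to.
-- Arrays: 0–3 input, 4/5 node of a character, 6/7 number of characters at a node,
-- 8 position + 1 of the latest child of a node (0 if none), 9 that child.

body : (pos chr cls cnt ptr : ℕ) → Program
body pos chr cls cnt ptr =
  set 6 (op add (read pos (reg ptr)) (const 1)) ∷
  set 7 (read chr (reg ptr)) ∷
  set ptr (op add (reg ptr) (const 1)) ∷
  set 8 (read cls (reg 7)) ∷
  ifThenElse (op eq (read 8 (reg 8)) (reg 6))
    (set 10 (read 9 (reg 8)) ∷ set 9 (reg 9) ∷ [])
    (set 10 (reg 9) ∷ set 9 (op add (reg 9) (const 1)) ∷ []) ∷
  write 8 (reg 8) (reg 6) ∷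
  write 9 (reg 8) (reg 10) ∷
  write cnt (reg 8) (op sub (read cnt (reg 8)) (const 1)) ∷
  write cls (reg 7) (reg 10) ∷
  write cnt (reg 10) (op add (read cnt (reg 10)) (const 1)) ∷ []

body₁ body₂ : Program
body₁ = body 0 1 4 6 4
body₂ = body 2 3 5 7 5

build : Cmd
build = while (op lt (op add (reg 4) (reg 5)) (op add (reg 2) (reg 3)))
  (ifThenElse (op lt (reg 4) (reg 2))
    (ifThenElse (op lt (reg 5) (reg 3))
      (ifThenElse (op lt (read 2 (reg 5)) (read 0 (reg 4))) body₂ body₁ ∷ [])
      body₁ ∷ [])
    body₂ ∷ [])

audit : Cmd
audit = while (reg 9)
  (set 9 (op sub (reg 9) (const 1)) ∷
   ifThenElse (op eq (read 6 (reg 9)) (read 7 (reg 9))) [] (set 0 (const 0) ∷ []) ∷ [])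

matching : Program
matching = set 9 (const 1) ∷ write 6 (const 0) (reg 1) ∷ write 7 (const 0) (reg 1) ∷
           build ∷ audit ∷ []

-- The invariant of the insertion loop.

record Memory : Set where
  constructor memory
  field
    ptr size        : ℕ
    pos chr cls cnt : ℕ → ℕ

memory₁ memory₂ : State → Memory
memory₁ s = memory (regs s 4) (regs s 2) (arrs s 0) (arrs s 1) (arrs s 4) (arrs s 6)
memory₂ s = memory (regs s 5) (regs s 3) (arrs s 2) (arrs s 3) (arrs s 5) (arrs s 7)

module _ {σ m : ℕ} where

  Entries : Set
  Entries = List (Fin m × Fin σ)

  -- E is the input, of which D has been processed and R remains.
  record Side (path : ℕ → List (Fin m)) (next : ℕ) (E D R : Entries) (M : Memory) : Set where
    open Memory M
    field
      split    : D ++ R ≡ E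
      sorted   : AllPairs _⊑_ R
      ptr-ok   : ptr ≡ length D
      size-ok  : size ≡ length E
      pos-ok   : pos ≗ at (map (toℕ ∘ proj₁) E)
      chr-ok   : chr ≗ at (map (toℕ ∘ proj₂) E)
      cls<     : ∀ (a : Fin σ) → cls (toℕ a) < next
      cls-path : ∀ (a : Fin σ) → path (cls (toℕ a)) ≡ occ a D
      cnt-ok   : ∀ c → cnt c ≡ count {σ} (cls ∘ toℕ) c

    size≡ : size ≡ ptr + length R
    size≡ = trans size-ok (trans (cong length (sym split))
              (trans (length-++ D) (cong (_+ length R) (sym ptr-ok))))

  open Side

  at-middle : ∀ {A : Set} (f : A → ℕ) D {e R} → at (map f (D ++ e ∷ R)) (length D) ≡ f e
  at-middle f []      = refl
  at-middle f (x ∷ D) = at-middle f D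

  module _ {path next E D R M i a} (S : Side path next E D ((i , a) ∷ R) M) where
    open Memory M

    pos-next : pos ptr ≡ toℕ i
    pos-next = trans (pos-ok S ptr) (trans (cong₂ (at ∘ map _) (sym (split S)) (ptr-ok S)) (at-middle _ D))

    chr-next : chr ptr ≡ toℕ a
    chr-next = trans (chr-ok S ptr) (trans (cong₂ (at ∘ map _) (sym (split S)) (ptr-ok S)) (at-middle _ D))

    ptr<size : ptr < size
    ptr<size = subst (ptr <_) (sym (size≡ S)) (m<m+n ptr z<s)

    -- The intermediate value of the counters is that of the other characters at the node c,
    -- also when d = c.
    move : ∀ {path′ next′ d} → (∀ {e} → e < next → path′ e ≡ path e) → next ≤ next′ →
      d < next′ → path′ d ≡ path (cls (toℕ a)) ∷ʳ i →
      let c = cls (toℕ a) in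
      ∃[ r ] cnt c ≡ suc r × r < σ × (cnt [ c ↦ r ]) d < σ ×
        Side path′ next′ E (D ∷ʳ (i , a)) R
          (memory (suc ptr) size pos chr (cls [ toℕ a ↦ d ])
            (cnt [ c ↦ r ] [ d ↦ suc ((cnt [ c ↦ r ]) d) ]))
    move {path′} {next′} {d} ext n≤ d< pd =
      r c , trans (cnt≡ c) (cong (λ b → bit b + r c) (≡⇒≡ᵇ-true {c} refl)) , r< c
      , subst (_< σ) (sym (cnt₁≡ d)) (r< d) , record
        { split    = trans (∷ʳ-++ D _ R) (split S)
        ; sorted   = AllPairs.tail (sorted S)
        ; ptr-ok   = trans (cong suc (ptr-ok S)) (sym (trans (length-++ D) (+-comm (length D) 1)))
        ; size-ok  = size-ok S
        ; pos-ok   = pos-ok S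
        ; chr-ok   = chr-ok S
        ; cls<     = cls′<
        ; cls-path = cls′-path
        ; cnt-ok   = cnt₂≡
        }
      where
      c    = cls (toℕ a)
      cls′ = cls [ toℕ a ↦ d ]
      cls-a : cls′ (toℕ a) ≡ d
      cls-a = updated cls {x = toℕ a} refl
      cls-other : ∀ b → b ≢ a → cls′ (toℕ b) ≡ cls (toℕ b)
      cls-other b b≢a = untouched cls (b≢a ∘ sym ∘ toℕ-injective)

      others = count-replace {σ} (cls ∘ toℕ) (cls′ ∘ toℕ) a cls-other
      r = proj₁ others
      r< = proj₂ (proj₂ (proj₂ others))
      cnt≡ : ∀ e → cnt e ≡ bit (c ≡ᵇ e) + r e
      cnt≡ e = trans (cnt-ok S e) (proj₁ (proj₂ others) e)
      cnt₁≡ : ∀ e → (cnt [ c ↦ r c ]) e ≡ r e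
      cnt₁≡ e with c ≟ e
      ... | yes refl = updated cnt {x = c} refl
      ... | no  c≢e  = trans (untouched cnt c≢e) (trans (cnt≡ e)
                         (cong (λ b → bit b + r e) (≢⇒≡ᵇ-false c≢e)))
      cnt₂≡ : ∀ e → (cnt [ c ↦ r c ] [ d ↦ suc ((cnt [ c ↦ r c ]) d) ]) e ≡ count {σ} (cls′ ∘ toℕ) e
      cnt₂≡ e = trans cnt₂-e (sym (trans (proj₁ (proj₂ (proj₂ others)) e)
                                         (cong (λ x → bit (x ≡ᵇ e) + r e) cls-a)))
        where
        cnt₂-e : (cnt [ c ↦ r c ] [ d ↦ suc ((cnt [ c ↦ r c ]) d) ]) e ≡ bit (d ≡ᵇ e) + r e
        cnt₂-e with d ≟ e
        ... | yes refl rewrite ≡⇒≡ᵇ-true {d} refl = cong suc (cnt₁≡ d)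
        ... | no  d≢e  rewrite ≢⇒≡ᵇ-false d≢e     = cnt₁≡ e

      cls′< : ∀ b → cls′ (toℕ b) < next′
      cls′< b with b Fin.≟ a
      ... | yes refl = subst (_< next′) (sym cls-a) d<
      ... | no  b≢a  = subst (_< next′) (sym (cls-other b b≢a)) (<-≤-trans (cls< S b) n≤)

      cls′-path : ∀ b → path′ (cls′ (toℕ b)) ≡ occ b (D ∷ʳ (i , a))
      cls′-path b with b Fin.≟ a
      ... | yes refl = trans (cong path′ cls-a) (trans pd (trans (cong (_∷ʳ i) (cls-path S a))
              (sym (trans (occ-++ a D _) (cong (occ a D ++_) (occ-∷-≡ {a = b} {D = []} refl))))))
      ... | no  b≢a  = trans (cong path′ (cls-other b b≢a)) (trans (ext (cls< S b)) (trans (cls-path S b)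
              (sym (trans (occ-++ b D _) (trans (cong (occ b D ++_) (occ-∷-≢ (b≢a ∘ sym))) (++-identityʳ _))))))

  ptr≮size : ∀ {path next E D M} → Side path next E D [] M → ¬ Memory.ptr M < Memory.size M
  ptr≮size {M = M} S = ≤⇒≯ (≤-reflexive (trans (size≡ S) (+-identityʳ _)))

  extend : ∀ {path path′ next next′ E D R M} → (∀ {e} → e < next → path′ e ≡ path e) → next ≤ next′ →
           Side path next E D R M → Side path′ next′ E D R M
  extend ext n≤ S = record
    { Side S
    ; cls<     = λ a → <-≤-trans (cls< S a) n≤
    ; cls-path = λ a → trans (ext (cls< S a)) (cls-path S a)
    }

  -- `recent₁` and `recent₂` say that no stamp exceeds a position still to come on either side,
  -- which is the hypothesis of `descend`. `room` charges each new node to the entry that creates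
  -- it; the extra one is the root.
  record Invariant (next : ℕ) (stamp child : ℕ → ℕ)
                   (E₁ D₁ R₁ : Entries) (M₁ : Memory) (E₂ D₂ R₂ : Entries) (M₂ : Memory) : Set where
    field
      path    : ℕ → List (Fin m)
      trie    : Trie path stamp child next
      side₁   : Side path next E₁ D₁ R₁ M₁
      side₂   : Side path next E₂ D₂ R₂ M₂
      recent₁ : ∀ c → All (λ e → stamp c ≤ suc (toℕ (proj₁ e))) R₁
      recent₂ : ∀ c → All (λ e → stamp c ≤ suc (toℕ (proj₁ e))) R₂
      room    : next + (length R₁ + length R₂) ≤ suc (length E₁ + length E₂)

  open Invariant

  -- By this symmetry `progress` is proved for the first side only.
  exchange : ∀ {next stamp child E₁ D₁ R₁ M₁ E₂ D₂ R₂ M₂} →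
             Invariant next stamp child E₁ D₁ R₁ M₁ E₂ D₂ R₂ M₂ →
             Invariant next stamp child E₂ D₂ R₂ M₂ E₁ D₁ R₁ M₁
  exchange {next} {E₁ = E₁} {R₁ = R₁} {E₂ = E₂} {R₂ = R₂} I = record
    { path    = path I
    ; trie    = trie I
    ; side₁   = side₂ I
    ; side₂   = side₁ I
    ; recent₁ = recent₂ I
    ; recent₂ = recent₁ I
    ; room    = subst₂ _≤_ (cong (next +_) (+-comm (length R₁) _)) (cong suc (+-comm (length E₁) _)) (room I)
    }

  -- `i` is minimal among the remaining positions, by sortedness on its own side and by assumption
  -- on the other, so the new stamp preserves both `recent` fields. The resulting memory has the
  -- form that the writes of `body` produce, intermediate counter value included.
  progress : ∀ {next stamp child E₁ D₁ R₁ M₁ E₂ D₂ R₂ M₂ i a d next′} → let open Memory M₁; c = cls (toℕ a) in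
    Invariant next stamp child E₁ D₁ ((i , a) ∷ R₁) M₁ E₂ D₂ R₂ M₂ →
    All (λ e → i Fin.≤ proj₁ e) R₂ →
    Descent c (suc (toℕ i)) stamp child next d next′ →
    ∃[ r ] cnt c ≡ suc r × r < σ × (cnt [ c ↦ r ]) d < σ ×
      Invariant next′ (stamp [ c ↦ suc (toℕ i) ]) (child [ c ↦ d ])
        E₁ (D₁ ∷ʳ (i , a)) R₁
        (memory (suc ptr) size pos chr (cls [ toℕ a ↦ d ])
          (cnt [ c ↦ r ] [ d ↦ suc ((cnt [ c ↦ r ]) d) ]))
        E₂ D₂ R₂ M₂
  progress {next} {stamp} {child} {E₁} {D₁} {R₁} {M₁} {E₂} {D₂} {R₂} {M₂} {i} {a} {d} {next′} I first desc =
    let c< = cls< (side₁ I) a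
        path′ , ext , n≤ , d< , pd , trie′ = descend (trie I) c< (All.head (recent₁ I c)) desc
        r , r≡ , r< , cnt< , side₁′ = move (side₁ I) ext n≤ d< pd
    in r , r≡ , r< , cnt< , record
      { path    = path′
      ; trie    = trie′
      ; side₁   = side₁′
      ; side₂   = extend ext n≤ (side₂ I)
      ; recent₁ = λ e → stamped e (AllPairs.head (sorted (side₁ I))) (All.tail (recent₁ I e))
      ; recent₂ = λ e → stamped e first (recent₂ I e)
      ; room    = ≤-trans (+-monoˡ-≤ _ (next′≤ desc))
                    (subst (_≤ suc (length E₁ + length E₂)) (+-suc next _) (room I))
      }
    where
    c = Memory.cls M₁ (toℕ a)
    stamped : ∀ e {R} → All (λ e → i Fin.≤ proj₁ e) R → All (λ x → stamp e ≤ suc (toℕ (proj₁ x))) R →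
              All (λ x → (stamp [ c ↦ suc (toℕ i) ]) e ≤ suc (toℕ (proj₁ x))) R
    stamped e i≤ st≤ with c ≟ e
    ... | yes refl = All.map (λ le → subst (_≤ _) (sym (updated stamp {x = c} refl)) (s≤s le)) i≤
    ... | no  c≢e  = All.map (subst (_≤ _) (sym (untouched stamp c≢e))) st≤
    next′≤ : Descent c (suc (toℕ i)) stamp child next d next′ → next′ ≤ suc next
    next′≤ (inj₁ (_ , _ , refl)) = n≤1+n next
    next′≤ (inj₂ (_ , _ , refl)) = ≤-refl

  start : ∀ {E n pos chr} → AllPairs _⊑_ E → n ≡ length E →
    pos ≗ at (map (toℕ ∘ proj₁) E) → chr ≗ at (map (toℕ ∘ proj₂) E) →
    Side (λ _ → []) 1 E [] E (memory 0 n pos chr (λ _ → 0) ((λ _ → 0) [ 0 ↦ σ ]))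
  start E-sorted n≡ pos≗ chr≗ = record
    { split    = refl
    ; sorted   = E-sorted
    ; ptr-ok   = refl
    ; size-ok  = n≡
    ; pos-ok   = pos≗
    ; chr-ok   = chr≗
    ; cls<     = λ _ → s≤s z≤n
    ; cls-path = λ _ → refl
    ; cnt-ok   = λ where
        zero    → sym (count-const σ {0} refl)
        (suc c) → sym (count-absent {σ} (λ _ → 0) (suc c) λ _ ())
    }

  -- What the final counters decide.

  SameOccurrences : Entries → Entries → Set
  SameOccurrences E₁ E₂ = Σ[ π ∈ Permutation′ σ ] (∀ a → occ a E₁ ≡ occ (π ⟨$⟩ʳ a) E₂)

  Decides : Entries → Entries → State → Set
  Decides E₁ E₂ s = regs s 0 ≢ 0 × SameOccurrences E₁ E₂ ⊎ regs s 0 ≡ 0 × ¬ SameOccurrences E₁ E₂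

  -- Three preparatory commands, 16 steps per entry, one step to leave `build`, then four steps per
  -- node and one step to leave `audit`.
  runtime : Entries → Entries → ℕ
  runtime E₁ E₂ = 3 + ((length E₁ + length E₂) * 16 + suc (suc (length E₁ + length E₂) * 4 + 1))

  module _ {next stamp child E₁ D₁ M₁ E₂ D₂ M₂}
           (I : Invariant next stamp child E₁ D₁ [] M₁ E₂ D₂ [] M₂) where
    private
      module M₁ = Memory M₁
      module M₂ = Memory M₂

      path-cls₁ : ∀ a → path I (M₁.cls (toℕ a)) ≡ occ a E₁
      path-cls₁ a = trans (cls-path (side₁ I) a)
        (cong (occ a) (trans (sym (++-identityʳ D₁)) (split (side₁ I))))

      path-cls₂ : ∀ a → path I (M₂.cls (toℕ a)) ≡ occ a E₂
      path-cls₂ a = trans (cls-path (side₂ I) a)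
        (cong (occ a) (trans (sym (++-identityʳ D₂)) (split (side₂ I))))

    agree⇒same : (∀ c → c < next → M₁.cnt c ≡ M₂.cnt c) → SameOccurrences E₁ E₂
    agree⇒same agree = π , λ a → trans (sym (path-cls₁ a)) (trans (cong (path I) (eqs a)) (path-cls₂ _))
      where
      perm = counts⇒permutation {σ} (M₁.cls ∘ toℕ) (M₂.cls ∘ toℕ) λ a →
        let c = M₁.cls (toℕ a)
        in trans (sym (cnt-ok (side₁ I) c)) (trans (agree c (cls< (side₁ I) a)) (cnt-ok (side₂ I) c))
      π = proj₁ perm
      eqs = proj₂ perm

    -- Equal occurrence lists are equal paths, hence equal node numbers by `path-injective`, so `π`
    -- matches the characters at each node. As this covers every `c`, a single differing cell
    -- refutes a match.
    same⇒agree : SameOccurrences E₁ E₂ → ∀ c → M₁.cnt c ≡ M₂.cnt c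
    same⇒agree (π , same) c = trans (cnt-ok (side₁ I) c) (trans
      (permutation⇒counts (M₁.cls ∘ toℕ) (M₂.cls ∘ toℕ) π (λ a →
        Trie.path-injective (trie I) (cls< (side₁ I) a) (cls< (side₂ I) _)
          (trans (path-cls₁ a) (trans (same a) (sym (path-cls₂ _))))) c)
      (sym (cnt-ok (side₂ I) c)))

-- Execution of the program: correctness and step counts.

Verdict : (f g : ℕ → ℕ) (answer n N : ℕ) → Set
Verdict f g answer n N = answer ≢ 0 × (∀ c → n ≤ c → c < N → f c ≡ g c)
                       ⊎ answer ≡ 0 × ∃[ c ] f c ≢ g c

module _ {w : ℕ} (1< : 1 < 2 ^ w) where

  -- Nodes from `n` up to `N` have been compared. A node costs a loop test, a decrement, a
  -- comparison and, on a mismatch, the assignment of 0; the final 1 is the failing test.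
  audit-halts : ∀ n {N r a t} → r 9 ≡ n → n < 2 ^ w → Verdict (a 6) (a 7) (r 0) n N →
    Halts w (n * 4 + 1) (audit ∷ [] , state r a t) (λ s → Verdict (a 6) (a 7) (regs s 0) 0 N)
  audit-halts zero    r≡ n< v = exit-rule w (evaluates r≡) (halts _ refl v)
  audit-halts (suc n) {N} {r} {a} r≡ n< v =
    enter-rule w (evaluates r≡) $ set-rule w (eval-dec w 1< r≡ n<) branch
    where
    keep : a 6 n ≡ a 7 n → Verdict (a 6) (a 7) (r 0) (suc n) N → Verdict (a 6) (a 7) (r 0) n N
    keep e (inj₁ (ans , agree)) = inj₁ (ans , λ c n≤c c<N → case m≤n⇒m<n∨m≡n n≤c of λ where
      (inj₁ n<c)  → agree c n<c c<N
      (inj₂ refl) → e)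
    keep e (inj₂ bad) = inj₂ bad
    branch : Halts w (2 + (n * 4 + 1)) _ _
    branch with a 6 n ≟ a 7 n
    ... | yes e = then-rule w (eval-eq w 1< {e = read 6 (reg 9)} {read 7 (reg 9)} refl refl e) $
                  halts-≤ w (n≤1+n _) $
                  audit-halts n refl (<-trans ≤-refl n<) (keep e v)
    ... | no ne = else-rule w (eval-≢ w 1< {e = read 6 (reg 9)} {read 7 (reg 9)} refl refl ne) $
                  set-rule w (evaluates $ wrap-small w (<-trans z<s 1<)) $
                  audit-halts n refl (<-trans ≤-refl n<) (inj₂ (refl , n , ne))

  -- Both branches take three steps and meet in one continuation that knows only `Descent`, so the
  -- rest of the body is verified once.
  descent-rule : ∀ {B k r a t Q c v} → r 8 ≡ c → r 6 ≡ v → suc (r 9) < 2 ^ w →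
    (∀ {d n} → Descent c v (a 8) (a 9) (r 9) d n →
               Halts w B (k , state (r [ 10 ↦ d ] [ 9 ↦ n ]) a t) Q) →
    Halts w (3 + B)
      (ifThenElse (op eq (read 8 (reg 8)) (reg 6))
         (set 10 (read 9 (reg 8)) ∷ set 9 (reg 9) ∷ [])
         (set 10 (reg 9) ∷ set 9 (op add (reg 9) (const 1)) ∷ []) ∷ k , state r a t) Q
  descent-rule {r = r} {a} refl refl n< h with a 8 (r 8) ≟ r 6
  ... | yes old = then-rule w (eval-eq w 1< {e = read 8 (reg 8)} {reg 6} refl refl old) $
                  set-rule w (evaluates refl) $ set-rule w (evaluates refl) $ h (inj₁ (old , refl , refl))
  ... | no  new = else-rule w (eval-≢ w 1< {e = read 8 (reg 8)} {reg 6} refl refl new) $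
                  set-rule w (evaluates refl) $ set-rule w (eval-inc w 1< {e = reg 9} refl n<) $
                  h (inj₂ (new , refl , refl))

module _ (w : ℕ) {σ m : ℕ} {{_ : NonZero m}} (E₁ E₂ : Entries {σ} {m})
         (fits : m + σ + (length E₁ + length E₂) < 2 ^ w) where

  m< : ∀ {x} → x ≤ m → x < 2 ^ w
  m< le = ≤-<-trans (≤-trans le (≤-trans (m≤m+n m σ) (m≤m+n (m + σ) _))) fits

  σ< : ∀ {x} → x ≤ σ → x < 2 ^ w
  σ< le = ≤-<-trans (≤-trans le (≤-trans (m≤n+m σ m) (m≤m+n (m + σ) _))) fits

  -- The root makes one node more than there are entries; `m`, being nonzero, pays for it.
  E< : ∀ {x} → x ≤ suc (length E₁ + length E₂) → x < 2 ^ w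
  E< le = ≤-<-trans (≤-trans le (+-monoˡ-≤ _ (≤-trans (>-nonZero⁻¹ m) (m≤m+n m σ)))) fits

  1< : 1 < 2 ^ w
  1< = E< (s≤s z≤n)

  record Correct (s : State) (D₁ R₁ D₂ R₂ : Entries {σ} {m}) : Set where
    constructor correct
    field
      answer    : regs s 0 ≡ m
      invariant : Invariant (regs s 9) (arrs s 8) (arrs s 9) E₁ D₁ R₁ (memory₁ s) E₂ D₂ R₂ (memory₂ s)

  open Correct
  open Invariant
  open Side

  length₁< : ∀ {x} → x ≤ length E₁ → x < 2 ^ w
  length₁< le = E< (m≤n⇒m≤1+n (≤-trans le (m≤m+n _ _)))

  length₂< : ∀ {x} → x ≤ length E₂ → x < 2 ^ w
  length₂< le = E< (m≤n⇒m≤1+n (≤-trans le (m≤n+m _ _)))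

  -- As long as an entry remains, `room` leaves space for one more node number.
  next< : ∀ {s D₁ R₁ D₂ R₂} → Correct s D₁ R₁ D₂ R₂ → 0 < length R₁ + length R₂ → suc (regs s 9) < 2 ^ w
  next< {s} C pos = E<
    (≤-trans (≤-reflexive (+-comm 1 (regs s 9))) (≤-trans (+-monoʳ-≤ (regs s 9) pos) (room (invariant C))))

  module _ {k : List Cmd} {B : ℕ} {Q : State → Set} {s : State} {i : Fin m} {a : Fin σ} where

    -- Twelve steps: four assignments, three for the descent, five writes. The final state computes
    -- to the memory given by `progress`, so its invariant is passed on as it is.
    body₁-rule : ∀ {D₁ R₁ D₂ R₂} → Correct s D₁ ((i , a) ∷ R₁) D₂ R₂ → All (λ e → i Fin.≤ proj₁ e) R₂ →
      (∀ {s} → Correct s (D₁ ∷ʳ (i , a)) R₁ D₂ R₂ → Halts w B (k , s) Q) →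
      Halts w (12 + B) (body₁ ++ k , s) Q
    body₁-rule C first h =
      set-rule w (eval-inc w 1< {e = read 0 (reg 4)} (pos-next S) (m< (toℕ<n i))) $
      set-rule w (evaluates (chr-next S)) $
      set-rule w (eval-inc w 1< {e = reg 4} refl (length₁< (subst (suc _ ≤_) (size-ok S) (ptr<size S)))) $
      set-rule w (evaluates refl) $
      descent-rule 1< refl refl (next< C z<s) λ desc →
      case progress (invariant C) first desc of λ where
        (_ , cnt≡ , r< , cnt< , I) →
          write-rule w (evaluates refl) (evaluates refl) $
          write-rule w (evaluates refl) (evaluates refl) $
          write-rule w (evaluates refl) (eval-dec w 1< {e = read 6 (reg 8)} cnt≡ (σ< r<)) $
          write-rule w (evaluates refl) (evaluates refl) $
          write-rule w (evaluates refl) (eval-inc w 1< {e = read 6 (reg 10)} refl (σ< cnt<)) $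
          h (correct (answer C) I)
      where
      S = side₁ (invariant C)

    body₂-rule : ∀ {D₁ R₁ D₂ R₂} → Correct s D₁ R₁ D₂ ((i , a) ∷ R₂) → All (λ e → i Fin.≤ proj₁ e) R₁ →
      (∀ {s} → Correct s D₁ R₁ (D₂ ∷ʳ (i , a)) R₂ → Halts w B (k , s) Q) →
      Halts w (12 + B) (body₂ ++ k , s) Q
    body₂-rule {R₁ = R₁} C first h =
      set-rule w (eval-inc w 1< {e = read 2 (reg 5)} (pos-next S) (m< (toℕ<n i))) $
      set-rule w (evaluates (chr-next S)) $
      set-rule w (eval-inc w 1< {e = reg 5} refl (length₂< (subst (suc _ ≤_) (size-ok S) (ptr<size S)))) $
      set-rule w (evaluates refl) $
      descent-rule 1< refl refl (next< C (<-≤-trans z<s (m≤n+m _ (length R₁)))) λ desc →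
      case progress (exchange (invariant C)) first desc of λ where
        (_ , cnt≡ , r< , cnt< , I) →
          write-rule w (evaluates refl) (evaluates refl) $
          write-rule w (evaluates refl) (evaluates refl) $
          write-rule w (evaluates refl) (eval-dec w 1< {e = read 7 (reg 8)} cnt≡ (σ< r<)) $
          write-rule w (evaluates refl) (evaluates refl) $
          write-rule w (evaluates refl) (eval-inc w 1< {e = read 7 (reg 10)} refl (σ< cnt<)) $
          h (correct (answer C) (exchange I))
      where
      S = side₂ (invariant C)

  module _ {s D₁ R₁ D₂ R₂} (C : Correct s D₁ R₁ D₂ R₂) where
    private
      S₁ = side₁ (invariant C)
      S₂ = side₂ (invariant C)

      size≤ : regs s 2 + regs s 3 ≤ suc (length E₁ + length E₂)
      size≤ = m≤n⇒m≤1+n (≤-reflexive (cong₂ _+_ (size-ok S₁) (size-ok S₂)))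

      size≡ptr : regs s 2 + regs s 3 ≡ regs s 4 + regs s 5 + (length R₁ + length R₂)
      size≡ptr = trans (cong₂ _+_ (size≡ S₁) (size≡ S₂)) (interchange (regs s 4) _ _ _)

      sizes : Evaluates w (op add (reg 2) (reg 3)) s (regs s 2 + regs s 3)
      sizes = eval-add w 1< {e = reg 2} {reg 3} refl refl (E< size≤)

      ptrs : Evaluates w (op add (reg 4) (reg 5)) s (regs s 4 + regs s 5)
      ptrs = eval-add w 1< {e = reg 4} {reg 5} refl refl
               (E< (≤-trans (m≤m+n _ _) (≤-trans (≤-reflexive (sym size≡ptr)) size≤)))

    open Evaluates

    unfinished : 0 < length R₁ + length R₂ →
      Evaluates w (op lt (op add (reg 4) (reg 5)) (op add (reg 2) (reg 3))) s 1
    unfinished pos = eval-lt w 1< {e = op add (reg 4) (reg 5)} {op add (reg 2) (reg 3)}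
      (value ptrs) (value sizes) (subst (regs s 4 + regs s 5 <_) (sym size≡ptr) (m<m+n _ pos))

    finished : length R₁ + length R₂ ≡ 0 →
      Evaluates w (op lt (op add (reg 4) (reg 5)) (op add (reg 2) (reg 3))) s 0
    finished none = eval-≮ w 1< {e = op add (reg 4) (reg 5)} {op add (reg 2) (reg 3)}
      (value ptrs) (value sizes)
      (≤⇒≯ (≤-reflexive (trans size≡ptr (trans (cong (regs s 4 + regs s 5 +_) none) (+-identityʳ _)))))

  -- The smaller head is at most the other head, hence at most everything behind it by sortedness.
  -- Ties go to the first string, as minimality need not be strict.
  merge-rule : ∀ {e₁ e₂ R₁ R₂ D₁ D₂ B k Q s} → Correct s D₁ (e₁ ∷ R₁) D₂ (e₂ ∷ R₂) →
    (∀ {s} → Correct s (D₁ ∷ʳ e₁) R₁ D₂ (e₂ ∷ R₂) → Halts w B (k , s) Q) →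
    (∀ {s} → Correct s D₁ (e₁ ∷ R₁) (D₂ ∷ʳ e₂) R₂ → Halts w B (k , s) Q) →
    Halts w (13 + B) (ifThenElse (op lt (read 2 (reg 5)) (read 0 (reg 4))) body₂ body₁ ∷ k , s) Q
  merge-rule {e₁} {e₂} C h₁ h₂ with side₁ (invariant C) | side₂ (invariant C) | proj₁ e₂ Fin.<? proj₁ e₁
  ... | S₁ | S₂ | yes i₂<i₁ =
    then-rule w (eval-lt w 1< {e = read 2 (reg 5)} {read 0 (reg 4)} (pos-next S₂) (pos-next S₁) i₂<i₁) $
    body₂-rule C (<⇒≤ i₂<i₁ ∷ All.map (≤-trans (<⇒≤ i₂<i₁)) (AllPairs.head (sorted S₁))) h₂
  ... | S₁ | S₂ | no i₂≮i₁ =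
    else-rule w (eval-≮ w 1< {e = read 2 (reg 5)} {read 0 (reg 4)} (pos-next S₂) (pos-next S₁) i₂≮i₁) $
    body₁-rule C (≮⇒≥ i₂≮i₁ ∷ All.map (≤-trans (≮⇒≥ i₂≮i₁)) (AllPairs.head (sorted S₂))) h₁

  -- The 16 steps are the loop test, two tests for exhausted input, the comparison of positions and
  -- the 12 of the body. Once a side is exhausted the route is shorter, and `halts-≤` fills the gap.
  build-rule : ∀ R₁ R₂ {B k Q s D₁ D₂} → Correct s D₁ R₁ D₂ R₂ →
    (∀ {s D₁ D₂} → Correct s D₁ [] D₂ [] → Halts w B (k , s) Q) →
    Halts w ((length R₁ + length R₂) * 16 + suc B) (build ∷ k , s) Q
  build-rule [] [] C h = exit-rule w (finished C refl) (h C)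
  build-rule (e₁ ∷ R₁) [] C h =
    halts-≤ w (n≤1+n _) $
    enter-rule w (unfinished C z<s) $
    then-rule w (eval-lt w 1< {e = reg 4} {reg 2} refl refl (ptr<size (side₁ (invariant C)))) $
    else-rule w (eval-≮ w 1< {e = reg 5} {reg 3} refl refl (ptr≮size (side₂ (invariant C)))) $
    body₁-rule C [] λ C′ → build-rule R₁ [] C′ h
  build-rule [] (e₂ ∷ R₂) C h =
    halts-≤ w (≤-trans (n≤1+n _) (n≤1+n _)) $
    enter-rule w (unfinished C z<s) $
    else-rule w (eval-≮ w 1< {e = reg 4} {reg 2} refl refl (ptr≮size (side₁ (invariant C)))) $
    body₂-rule C [] λ C′ → build-rule [] R₂ C′ h
  build-rule (e₁ ∷ R₁) (e₂ ∷ R₂) {B} C h =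
    enter-rule w (unfinished C z<s) $
    then-rule w (eval-lt w 1< {e = reg 4} {reg 2} refl refl (ptr<size (side₁ (invariant C)))) $
    then-rule w (eval-lt w 1< {e = reg 5} {reg 3} refl refl (ptr<size (side₂ (invariant C)))) $
    merge-rule C
      (λ C′ → build-rule R₁ (e₂ ∷ R₂) C′ h)
      (λ C′ → halts-≤ w (≤-reflexive (cong (λ n → n * 16 + suc B) (sym (+-suc (length R₁) (length R₂))))) $
              build-rule (e₁ ∷ R₁) R₂ C′ h)

  audit-decides : ∀ {s D₁ D₂} → Correct s D₁ [] D₂ [] →
    Halts w (suc (length E₁ + length E₂) * 4 + 1) (audit ∷ [] , s) (Decides E₁ E₂)
  audit-decides {s} (correct ans I) =
    halts-≤ w (+-monoˡ-≤ 1 (*-monoˡ-≤ 4 next≤)) $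
    halts-map w (λ {s′} → decide {s′}) $
    audit-halts 1< (regs s 9) {N = regs s 9} {r = regs s} {a = arrs s} refl (E< next≤)
      -- Before the audit the range of compared nodes is empty, and register 0 still holds `m`,
      -- which is nonzero and thus means acceptance.
      (inj₁ ((λ z → ≢-nonZero⁻¹ m (trans (sym ans) z)) , λ c n≤c c<n → contradiction c<n (≤⇒≯ n≤c)))
    where
    next≤ : regs s 9 ≤ suc (length E₁ + length E₂)
    next≤ = ≤-trans (m≤m+n _ 0) (room I)
    decide : ∀ {s′} → Verdict (arrs s 6) (arrs s 7) (regs s′ 0) 0 (regs s 9) → Decides E₁ E₂ s′
    decide (inj₁ (yes′ , agree))   = inj₁ (yes′ , agree⇒same I (λ c → agree c z≤n))
    decide (inj₂ (no′ , c , differ)) = inj₂ (no′ , λ same → differ (same⇒agree I same c))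

-- From occurrence lists back to set-strings, and the linear time bound.

module _ {σ m w : ℕ} {{_ : NonZero m}} {S₁ S₂ : SetString σ m} (L₁ : Listing S₁) (L₂ : Listing S₂) where
  private
    E₁ = Listing.entries L₁
    E₂ = Listing.entries L₂

  matching-decides : (fits : m + σ + (length E₁ + length E₂) < 2 ^ w) → ∀ t →
    Halts w (runtime E₁ E₂)
      (matching , state (inputRegs L₁ L₂) (inputArrs L₁ L₂) t) (Decides E₁ E₂)
  matching-decides fits t =
    set-rule w (evaluates (wrap-small w (1< w E₁ E₂ fits))) $
    write-rule w zero-evaluates (evaluates refl) $
    write-rule w zero-evaluates (evaluates refl) $
    build-rule w E₁ E₂ fits E₁ E₂ (correct refl record
      { path    = λ _ → []
      ; trie    = singleton
      ; side₁   = start (entries-sorted L₁) refl (λ _ → refl) (λ _ → refl)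
      ; side₂   = start (entries-sorted L₂) refl (λ _ → refl) (λ _ → refl)
      ; recent₁ = λ _ → All.universal (λ _ → z≤n) E₁
      ; recent₂ = λ _ → All.universal (λ _ → z≤n) E₂
      ; room    = ≤-refl
      }) (audit-decides w E₁ E₂ fits)
    where
    zero-evaluates : ∀ {s} → Evaluates w (const 0) s 0
    zero-evaluates = evaluates (wrap-small w (m^n>0 2 w))

  same⇒≈ₚ : SameOccurrences E₁ E₂ → S₁ ≈ₚ S₂
  same⇒≈ₚ (π , same) = supports⇒≈ₚ {S₁ = S₁} {S₂} π λ a →
    trans (sym (occ-entries L₁ a)) (trans (same a) (occ-entries L₂ _))

  ≈ₚ⇒same : S₁ ≈ₚ S₂ → SameOccurrences E₁ E₂
  ≈ₚ⇒same match = proj₁ match , λ a →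
    trans (occ-entries L₁ a) (trans (≈ₚ⇒supports {S₁ = S₁} {S₂} match a) (sym (occ-entries L₂ _)))

  outcome : m + σ + (∥ S₁ ∥ + ∥ S₂ ∥) < 2 ^ w → let T = 20 * (∥ S₁ ∥ + ∥ S₂ ∥ + 1) in
    (r : Tape w T) → let C = run L₁ L₂ matching w T r in
    Halted {w} C × (accepts {w} C ≡ true × S₁ ≈ₚ S₂ ⊎ accepts {w} C ≡ false × ¬ S₁ ≈ₚ S₂)
  outcome bound r = from-halts (halts-≤ w time (matching-decides fits _))
    where
    T = 20 * (∥ S₁ ∥ + ∥ S₂ ∥ + 1)
    size = +-mono-≤ (length-entries L₁) (length-entries L₂)
    -- The bounds of the statement are in terms of the set sizes, while the program works with
    -- entries, which are no more numerous.
    fits = ≤-<-trans (+-monoʳ-≤ (m + σ) size) bound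
    -- For `M` entries the running time is `20 * M + 9`, which explains the constant 20; 11 steps
    -- are left over.
    linear : ∀ M → 20 * (M + 1) ≡ 3 + (M * 16 + suc (suc M * 4 + 1)) + 11
    linear = solve-∀
    time : runtime E₁ E₂ ≤ T
    time = ≤-trans (m+n≤o⇒m≤o _ (≤-reflexive (sym (linear (length E₁ + length E₂)))))
                   (*-monoʳ-≤ 20 (+-monoˡ-≤ 1 size))
    from-halts : Halts w T (matching , state (inputRegs L₁ L₂) (inputArrs L₁ L₂) (map toℕ (Vec.toList r)))
                   (Decides E₁ E₂) →
      let C = run L₁ L₂ matching w T r in
      Halted {w} C × (accepts {w} C ≡ true × S₁ ≈ₚ S₂ ⊎ accepts {w} C ≡ false × ¬ S₁ ≈ₚ S₂)
    from-halts (halts s h (inj₁ (ans , same))) = cong proj₁ h ,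
      inj₁ (trans (cong (accepts {w}) h) (cong not (≢⇒≡ᵇ-false ans)) , same⇒≈ₚ same)
    from-halts (halts s h (inj₂ (ans , differ))) = cong proj₁ h ,
      inj₂ (trans (cong (accepts {w}) h) (cong not (≡⇒≡ᵇ-true ans)) , differ ∘ ≈ₚ⇒same)

open import Data.Integer using (+_)

never⇒Pr≤ : ∀ w T {E : Tape w T → Bool} m {{_ : NonZero m}} → (∀ r → E r ≡ false) →
            Pr w T E ℚ.≤ + 1 ℚ./ m
never⇒Pr≤ w T {E} m never = subst (ℚ._≤ + 1 ℚ./ m)
  (sym (trans (cong (λ n → ℚ._/_ (+ n) N {{N≢0}}) (cong length none)) (ℚ.0/n≡0 N {{N≢0}})))
  (ℚ.nonNegative⁻¹ (+ 1 ℚ./ m) {{ℚ.normalize-nonNeg 1 m}})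
  where
  N = (2 ^ w) ^ T
  N≢0 = m^n≢0 (2 ^ w) T {{m^n≢0 2 w}}
  none : filterᵇ E (allTapes w T) ≡ []
  none = filter-none (T? ∘ E) (All.universal (λ r → subst (¬_ ∘ Bool.T) (sym (never r)) id) (allTapes w T))

theorem2 : ∃[ P ] ∃[ c ]
    (∀ (σ m : ℕ) {{_ : NonZero m}} (S₁ S₂ : SetString σ m)
    (L₁ : Listing S₁) (L₂ : Listing S₂) (w : ℕ) →
    m + σ + (∥ S₁ ∥ + ∥ S₂ ∥) < 2 ^ w →
    let T = c * (∥ S₁ ∥ + ∥ S₂ ∥ + 1) in
    ((r : Tape w T) → Halted {w} (run L₁ L₂ P w T r))
    × (S₁ ≈ₚ S₂ → Pr w T (λ r → not (accepts {w} (run L₁ L₂ P w T r))) ℚ.≤ + 1 ℚ./ m)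
    × (¬ (S₁ ≈ₚ S₂) → Pr w T (λ r → accepts {w} (run L₁ L₂ P w T r)) ℚ.≤ + 1 ℚ./ m))
theorem2 = matching , 20 , λ σ m S₁ S₂ L₁ L₂ w bound →
    (λ r → proj₁ (outcome L₁ L₂ bound r))
  , (λ match → never⇒Pr≤ w _ m λ r → case proj₂ (outcome L₁ L₂ bound r) of λ where
      (inj₁ (acc , _)) → cong not acc
      (inj₂ (_ , ¬match)) → contradiction match ¬match)
  , (λ ¬match → never⇒Pr≤ w _ m λ r → case proj₂ (outcome L₁ L₂ bound r) of λ where
      (inj₁ (_ , match)) → contradiction match ¬match
      (inj₂ (rej , _)) → rej)
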